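{- Let $a,b,r$ be integers with $r\geqslant 1$, and let $\mathcal{G}=(\mathcal{G}_n)_{n\geqslant 0}$ be the sequence with $\mathcal{G}_0=a$, $\mathcal{G}_1=b$ and $\mathcal{G}_n=r\mathcal{G}_{n-1}+\mathcal{G}_{n-2}$ for $n\geqslant 2$. Let $\tilde{\mathcal{G}}=(\tilde{\mathcal{G}}_n)_{n\geqslant 0}$ with $\tilde{\mathcal{G}}_n=(-1)^n\mathcal{G}_n$. Then for every nonnegative integer $n$, $$\det T_{\tilde{\mathcal{G}},\mathcal{G}}(n)=\begin{cases} a & \text{if } n=0,\\ (2b-ar)^{n-1}\,(a\mathcal{G}_{n-1}+b\mathcal{G}_n) & \text{if } n\geqslant 1.\end{cases}$$
   Context: For sequences $\alpha=(\alpha_i)_{i\geqslant 0}$ and $\beta=(\beta_i)_{i\geqslant 0}$ with $\alpha_0=\beta_0$, $T_{\alpha,\beta}(n)=[T_{i,j}]_{0\leqslant i,j\leqslant n}$ is the Toeplitz matrix of order $n+1$ with first column $T_{i,0}=\alpha_i$ and first row $T_{0,i}=\beta_i$ ($0\leqslant i\leqslant n$), and $T_{i,j}=T_{k,l}$ whenever $i-j=k-l$. The convention $x^0=1$ (including $x=0$) is used. -}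

module Defs where

open import Data.Fin.Base using (Fin; zero; suc; toℕ)
open import Data.Integer.Base using (ℤ; _+_; _*_; _^_; 1ℤ; -1ℤ)
open import Data.Integer.Properties using (+-0-commutativeMonoid; *-identityˡ)
open import Data.Nat.Base as ℕ using (ℕ; zero; suc)
import Data.Nat.Properties as ℕ
open import Data.Vec.Functional using (Vector; removeAt)
open import Relation.Binary.PropositionalEquality using (_≡_; refl; sym; trans; cong)
open import Algebra.Properties.CommutativeMonoid.Sum +-0-commutativeMonoid using (sum)

SquareMatrix : ℕ → Set
SquareMatrix n = Vector (Vector ℤ n) n

minor : ∀ {n} → SquareMatrix (suc n) → Fin (suc n) → Fin (suc n) → SquareMatrix n
minor M i j k = removeAt (removeAt M i k) j

-- Laplace expansion along the first row; the empty matrix has determinant 1.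
det : ∀ {n} → SquareMatrix n → ℤ
det {zero}  M = 1ℤ
det {suc n} M = sum λ j → -1ℤ ^ toℕ j * M zero j * det (minor M zero j)

-- The infinite Toeplitz array with first column α and first row β. The
-- corner is read from α, so this is meaningful only when α 0 ≡ β 0.
toeplitzEntry : (α β : ℕ → ℤ) → ℕ → ℕ → ℤ
toeplitzEntry α β i       zero    = α i
toeplitzEntry α β zero    (suc j) = β (suc j)
toeplitzEntry α β (suc i) (suc j) = toeplitzEntry α β i j

-- The order is n + 1, as the indices satisfy 0 ≤ i, j ≤ n.
toeplitz : (α β : ℕ → ℤ) (n : ℕ) → SquareMatrix (suc n)
toeplitz α β n i j = toeplitzEntry α β (toℕ i) (toℕ j)

toeplitzEntry-row : ∀ α β → α 0 ≡ β 0 → ∀ j → toeplitzEntry α β 0 j ≡ β j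
toeplitzEntry-row α β α₀≡β₀ zero    = α₀≡β₀
toeplitzEntry-row α β α₀≡β₀ (suc j) = refl

-- The hypothesis is i - j = k - l, with the subtractions cleared.
toeplitzEntry-diagonal : ∀ α β i j k l → i ℕ.+ l ≡ k ℕ.+ j →
                         toeplitzEntry α β i j ≡ toeplitzEntry α β k l
toeplitzEntry-diagonal α β (suc i) (suc j) k l eq =
  toeplitzEntry-diagonal α β i j k l
    (ℕ.suc-injective (trans eq (ℕ.+-suc k j)))
toeplitzEntry-diagonal α β i@zero j@(suc _) (suc k) (suc l) eq =
  toeplitzEntry-diagonal α β i j k l (ℕ.suc-injective eq)
toeplitzEntry-diagonal α β i j@zero (suc k) (suc l) eq =
  toeplitzEntry-diagonal α β i j k l
    (ℕ.suc-injective (trans (sym (ℕ.+-suc i l)) eq))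
toeplitzEntry-diagonal α β i zero k zero eq =
  cong α (trans (sym (ℕ.+-identityʳ i)) (trans eq (ℕ.+-identityʳ k)))
toeplitzEntry-diagonal α β i zero zero (suc l) eq with () ← trans (sym (ℕ.+-suc i l)) eq
toeplitzEntry-diagonal α β zero (suc j) k zero eq with () ← trans eq (ℕ.+-suc k j)
toeplitzEntry-diagonal α β zero (suc j) zero (suc l) eq =
  cong β (sym eq)

𝒢 : (a b r : ℤ) → ℕ → ℤ
𝒢 a b r 0             = a
𝒢 a b r 1             = b
𝒢 a b r (suc (suc n)) = r * 𝒢 a b r (suc n) + 𝒢 a b r n

alternating : (ℕ → ℤ) → ℕ → ℤ
alternating γ n = -1ℤ ^ n * γ n

alternating₀ : ∀ γ → alternating γ 0 ≡ γ 0
alternating₀ γ = *-identityˡ (γ 0)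

{-# OPTIONS --safe #-}
-- Subtracting r times the second row and the third row from the first turns
-- the first row into (2b - ar) e₁, because the recurrence, read along the
-- diagonals, fails only across the main diagonal. The minor that remains is
-- the same Toeplitz array with its first column shifted up by one; so the
-- whole determinant is computed by induction, keeping the first column
-- arbitrary among the sequences with c i = r c (i + 1) + c (i + 2).
module Submission where

open import Defs
open import Data.Integer.Base using (ℤ; +_; _+_; _-_; _*_; _^_; _≤_)
open import Data.Nat.Base as ℕ using (ℕ; _∸_)
open import Data.Product.Base using (_×_)
open import Relation.Binary.PropositionalEquality using (_≡_)
open import Data.Fin.Base using (Fin; zero; suc; toℕ; punchIn; lift)
open import Data.Integer.Base using (-_; 0ℤ; 1ℤ; -1ℤ)
open import Data.Integer.Properties
  using (+-0-commutativeMonoid; +-*-semiring; *-cancelˡ-≡; *-zeroʳ; *-assoc)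
open import Data.Integer.Tactic.RingSolver using (solve-∀)
open import Data.Nat.Base using (zero; suc)
open import Data.Product.Base using (_,_)
open import Data.Vec.Functional using (Vector; _∷_; tail)
open import Function.Base using (_∘_)
open import Relation.Binary.PropositionalEquality
  using (_≗_; refl; sym; trans; cong; cong₂; module ≡-Reasoning)
open import Algebra.Properties.CommutativeMonoid.Sum +-0-commutativeMonoid
  using (sum; sum-cong-≗; ∑-distrib-+; sum-replicate-zero)
open import Algebra.Properties.Semiring.Sum +-*-semiring using (*-distribˡ-sum)

open ≡-Reasoning

-- Determinants under exchange and repetition of rows.

sign : ∀ {n} → Fin n → ℤ
sign j = -1ℤ ^ toℕ j

sum-zero : ∀ {n} (f : Vector ℤ n) → (∀ i → f i ≡ 0ℤ) → sum f ≡ 0ℤ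
sum-zero {n} f f≗0 = trans (sum-cong-≗ f≗0) (sum-replicate-zero n)

det-cong : ∀ {n} {M N : SquareMatrix n} → (∀ i j → M i j ≡ N i j) → det M ≡ det N
det-cong {zero}  M≗N = refl
det-cong {suc n} M≗N = sum-cong-≗ λ j →
  cong₂ (λ m d → sign j * m * d) (M≗N zero j)
    (det-cong λ i k → M≗N (suc i) (punchIn j k))

-- The first two rows x and y of a determinant, expanded; F stands for the minor
-- of the remaining rows as a function of the columns kept.
expand₂ : ∀ {n} (x y : Vector ℤ (suc (suc n))) →
          ((Fin n → Fin (suc (suc n))) → ℤ) → ℤ
expand₂ x y F = sum λ j → sign j * x j *
  sum λ k → sign k * y (punchIn j k) * F (punchIn j ∘ punchIn k)

-- The share of the double expansion in which the other of the two rows takes column zero; that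
-- row's entry and the sign of the pair are left out.
expandTail : ∀ {n} → ((Fin n → Fin (suc (suc n))) → ℤ) → Vector ℤ (suc (suc n)) → ℤ
expandTail F z = sum λ k → sign k * z (suc k) * F (suc ∘ punchIn k)

punchIn-lift : ∀ {n} (j : Fin (suc (suc n))) (k : Fin (suc n)) →
               punchIn (suc j) ∘ punchIn (suc k) ≗ lift 1 (punchIn j ∘ punchIn k)
punchIn-lift j k zero    = refl
punchIn-lift j k (suc i) = refl

-- The pairs of columns are sorted by whether `x` takes column zero, `y` does, or neither. In the
-- second group the shifted index of `x` costs one sign; in the third the shifts of both indices
-- cancel, and `lift 1` records that column zero survives in the minor. Column selections agree only
-- pointwise, hence `F-cong`.
expand₂-suc : ∀ {n} (x y : Vector ℤ (suc (suc (suc n)))) F →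
  (∀ {f g} → f ≗ g → F f ≡ F g) →
  expand₂ x y F ≡ x zero * expandTail F y +
    (- y zero * expandTail F x + expand₂ (tail x) (tail y) (F ∘ lift 1))
expand₂-suc x y F F-cong = cong₂ _+_ (first (x zero) (A y)) (begin
  sum (λ j → -1ℤ * sign j * x (suc j) *
    (1ℤ * y zero * F (suc ∘ punchIn j) +
     sum (λ k → -1ℤ * sign k * y (suc (punchIn j k)) * F (punchIn (suc j) ∘ punchIn (suc k)))))
    ≡⟨ sum-cong-≗ (λ j → trans
         (cong (λ s → -1ℤ * sign j * x (suc j) * (1ℤ * y zero * F (suc ∘ punchIn j) + s))
           (inner j))
         (split (sign j) (x (suc j)) (y zero) (F (suc ∘ punchIn j)) _)) ⟩
  sum (λ j → - y zero * a j + b j)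
    ≡⟨ ∑-distrib-+ (λ j → - y zero * a j) b ⟩
  sum (λ j → - y zero * a j) + sum b
    ≡⟨ cong (_+ sum b) (sym (*-distribˡ-sum (- y zero) a)) ⟩
  - y zero * A x + sum b ∎)
  where
  A : Vector ℤ _ → ℤ
  A = expandTail F

  c : Fin _ → Vector ℤ _
  c j k = sign k * y (suc (punchIn j k)) * F (lift 1 (punchIn j ∘ punchIn k))

  a b : Vector ℤ _
  a j = sign j * x (suc j) * F (suc ∘ punchIn j)
  b j = sign j * x (suc j) * sum (c j)

  first : ∀ u v → 1ℤ * u * v ≡ u * v
  first = solve-∀

  negate : ∀ s u v → -1ℤ * s * u * v ≡ -1ℤ * (s * u * v)
  negate = solve-∀

  split : ∀ s u v f t → -1ℤ * s * u * (1ℤ * v * f + -1ℤ * t) ≡ - v * (s * u * f) + s * u * t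
  split = solve-∀

  inner : ∀ j →
    sum (λ k → -1ℤ * sign k * y (suc (punchIn j k)) * F (punchIn (suc j) ∘ punchIn (suc k))) ≡
    -1ℤ * sum (c j)
  inner j = trans
    (sum-cong-≗ λ k → trans
      (cong (-1ℤ * sign k * y (suc (punchIn j k)) *_) (F-cong (punchIn-lift j k)))
      (negate (sign k) (y (suc (punchIn j k))) _))
    (sym (*-distribˡ-sum -1ℤ (c j)))

lift-cong : ∀ {m n} {f g : Fin m → Fin n} → f ≗ g → lift 1 f ≗ lift 1 g
lift-cong f≗g zero    = refl
lift-cong f≗g (suc i) = cong suc (f≗g i)

-- By induction on the number of columns: exchanging `x` and `y` interchanges the first two groups
-- of `expand₂-suc`, which carry opposite signs, and the third group is the induction hypothesis.
expand₂-swap : ∀ {n} (x y : Vector ℤ (suc (suc n))) F →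
  (∀ {f g} → f ≗ g → F f ≡ F g) → expand₂ x y F ≡ - expand₂ y x F
expand₂-swap {zero} x y F F-cong = begin
  expansion x y q ≡⟨ cong (expansion x y) q≡p ⟩
  expansion x y p ≡⟨ swap₂ (x zero) (x (suc zero)) (y zero) (y (suc zero)) p ⟩
  - expansion y x p ≡⟨ cong (λ w → - expansion y x w) (sym q≡p) ⟩
  - expansion y x q ∎
  where
  p q : ℤ
  p = F (punchIn zero ∘ punchIn zero)
  q = F (punchIn (suc zero) ∘ punchIn zero)
  q≡p : q ≡ p
  -- Both selections are functions out of `Fin 0`.
  q≡p = F-cong λ ()
  expansion : (x y : Vector ℤ 2) → ℤ → ℤ
  expansion x y w = 1ℤ * x zero * (1ℤ * y (suc zero) * p + 0ℤ) +
    (-1ℤ * 1ℤ * x (suc zero) * (1ℤ * y zero * w + 0ℤ) + 0ℤ)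
  swap₂ : ∀ x₀ x₁ y₀ y₁ p →
    1ℤ * x₀ * (1ℤ * y₁ * p + 0ℤ) + (-1ℤ * 1ℤ * x₁ * (1ℤ * y₀ * p + 0ℤ) + 0ℤ) ≡
    - (1ℤ * y₀ * (1ℤ * x₁ * p + 0ℤ) + (-1ℤ * 1ℤ * y₁ * (1ℤ * x₀ * p + 0ℤ) + 0ℤ))
  swap₂ = solve-∀
expand₂-swap {suc n} x y F F-cong = begin
  expand₂ x y F
    ≡⟨ expand₂-suc x y F F-cong ⟩
  x zero * A y + (- y zero * A x + expand₂ (tail x) (tail y) (F ∘ lift 1))
    ≡⟨ cong (λ e → x zero * A y + (- y zero * A x + e))
         (expand₂-swap (tail x) (tail y) (F ∘ lift 1) (F-cong ∘ lift-cong)) ⟩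
  x zero * A y + (- y zero * A x + - expand₂ (tail y) (tail x) (F ∘ lift 1))
    ≡⟨ rearrange (x zero) (A y) (y zero) (A x) _ ⟩
  - (y zero * A x + (- x zero * A y + expand₂ (tail y) (tail x) (F ∘ lift 1)))
    ≡⟨ cong -_ (sym (expand₂-suc y x F F-cong)) ⟩
  - expand₂ y x F ∎
  where
  A : Vector ℤ _ → ℤ
  A = expandTail F
  rearrange : ∀ u v w z e → u * v + (- w * z + - e) ≡ - (w * z + (- u * v + e))
  rearrange = solve-∀

-- Two Laplace expansions in succession unfold to `expand₂`.
det-swap₀₁ : ∀ {n} (x y : Vector ℤ (suc (suc n))) R → det (x ∷ y ∷ R) ≡ - det (y ∷ x ∷ R)
det-swap₀₁ x y R = expand₂-swap x y (λ f → det λ i → R i ∘ f)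
  (λ f≗g → det-cong λ i j → cong (R i) (f≗g j))

-- Absence of 2-torsion turns antisymmetry into vanishing on repeated rows.
i≡-i⇒i≡0 : ∀ i → i ≡ - i → i ≡ 0ℤ
i≡-i⇒i≡0 i i≡-i = *-cancelˡ-≡ (+ 2) i 0ℤ
  (trans (double i) (trans (cong (_+ i) i≡-i) (cancel i)))
  where
  double : ∀ i → + 2 * i ≡ i + i
  double = solve-∀
  cancel : ∀ i → - i + i ≡ + 2 * 0ℤ
  cancel = solve-∀

det-repeat₀₁ : ∀ {n} (x : Vector ℤ (suc (suc n))) R → det (x ∷ x ∷ R) ≡ 0ℤ
det-repeat₀₁ x R = i≡-i⇒i≡0 _ (det-swap₀₁ x x R)

-- Every minor in the expansion along `x` begins with two equal rows.
det-repeat₁₂ : ∀ {n} (x y : Vector ℤ (suc (suc (suc n)))) R → det (x ∷ y ∷ y ∷ R) ≡ 0ℤ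
det-repeat₁₂ x y R = sum-zero _ λ j → trans
  (cong (sign j * x j *_)
    (trans (det-cong (minor-rows j))
      (det-repeat₀₁ (y ∘ punchIn j) (λ i → R i ∘ punchIn j))))
  (*-zeroʳ (sign j * x j))
  where
  minor-rows : ∀ j i k → minor (x ∷ y ∷ y ∷ R) zero j i k ≡
    ((y ∘ punchIn j) ∷ (y ∘ punchIn j) ∷ (λ i → R i ∘ punchIn j)) i k
  minor-rows j zero          k = refl
  minor-rows j (suc zero)    k = refl
  minor-rows j (suc (suc i)) k = refl

det-repeat₀₂ : ∀ {n} (x y : Vector ℤ (suc (suc (suc n)))) R → det (x ∷ y ∷ x ∷ R) ≡ 0ℤ
det-repeat₀₂ x y R = trans (det-swap₀₁ x y (x ∷ R)) (cong -_ (det-repeat₁₂ y x R))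

-- Linearity in the first row and row operations.

det-linear₀ : ∀ {n} (p q : ℤ) (x y z : Vector ℤ (suc n)) R →
  det ((λ j → x j + (p * y j + q * z j)) ∷ R) ≡
  det (x ∷ R) + (p * det (y ∷ R) + q * det (z ∷ R))
det-linear₀ p q x y z R = begin
  sum (λ j → sign j * (x j + (p * y j + q * z j)) * D j)
    ≡⟨ sum-cong-≗ (λ j → distribute (sign j) (x j) p (y j) q (z j) (D j)) ⟩
  sum (λ j → term x j + (p * term y j + q * term z j))
    ≡⟨ ∑-distrib-+ (term x) (λ j → p * term y j + q * term z j) ⟩
  sum (term x) + sum (λ j → p * term y j + q * term z j)
    ≡⟨ cong (λ s → sum (term x) + s) (∑-distrib-+ (λ j → p * term y j) (λ j → q * term z j)) ⟩
  sum (term x) + (sum (λ j → p * term y j) + sum (λ j → q * term z j))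
    ≡⟨ cong (λ s → sum (term x) + s) (sym (cong₂ _+_
         (*-distribˡ-sum p (term y)) (*-distribˡ-sum q (term z)))) ⟩
  sum (term x) + (p * sum (term y) + q * sum (term z)) ∎
  where
  D : Vector ℤ _
  D j = det (λ i → R i ∘ punchIn j)
  term : Vector ℤ _ → Vector ℤ _
  term w j = sign j * w j * D j
  distribute : ∀ s x p y q z d →
    s * (x + (p * y + q * z)) * d ≡ s * x * d + (p * (s * y * d) + q * (s * z * d))
  distribute = solve-∀

-- By linearity, each added row contributes a determinant with a repeated row.
det-addRows : ∀ {n} (p q : ℤ) (x y z : Vector ℤ (suc (suc (suc n)))) R →
  det ((λ j → x j + (p * y j + q * z j)) ∷ y ∷ z ∷ R) ≡ det (x ∷ y ∷ z ∷ R)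
det-addRows p q x y z R = begin
  det ((λ j → x j + (p * y j + q * z j)) ∷ y ∷ z ∷ R)
    ≡⟨ det-linear₀ p q x y z (y ∷ z ∷ R) ⟩
  det (x ∷ y ∷ z ∷ R) + (p * det (y ∷ y ∷ z ∷ R) + q * det (z ∷ y ∷ z ∷ R))
    ≡⟨ cong₂ (λ u v → det (x ∷ y ∷ z ∷ R) + (p * u + q * v))
         (det-repeat₀₁ y (z ∷ R)) (det-repeat₀₂ z y R) ⟩
  det (x ∷ y ∷ z ∷ R) + (p * 0ℤ + q * 0ℤ)
    ≡⟨ vanish (det (x ∷ y ∷ z ∷ R)) p q ⟩
  det (x ∷ y ∷ z ∷ R) ∎
  where
  vanish : ∀ d p q → d + (p * 0ℤ + q * 0ℤ) ≡ d
  vanish = solve-∀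

det-singleEntry₁ : ∀ {n} (M : SquareMatrix (suc (suc n))) →
  M zero zero ≡ 0ℤ → (∀ j → M zero (suc (suc j)) ≡ 0ℤ) →
  det M ≡ - M zero (suc zero) * det (minor M zero (suc zero))
det-singleEntry₁ M M₀≡0 M₂₊≡0 = trans
  (cong₂ (λ u v → 1ℤ * u * D zero + (-1ℤ * 1ℤ * M zero (suc zero) * D (suc zero) + v))
    M₀≡0
    (sum-zero _ λ j → trans (cong (λ u → sign (suc (suc j)) * u * D (suc (suc j))) (M₂₊≡0 j))
                        (annihilate (sign (suc (suc j))) (D (suc (suc j))))))
  (simplify (D zero) (M zero (suc zero)) (D (suc zero)))
  where
  D : Vector ℤ _
  D j = det (minor M zero j)
  annihilate : ∀ s d → s * 0ℤ * d ≡ 0ℤ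
  annihilate = solve-∀
  simplify : ∀ d₀ m d₁ → 1ℤ * 0ℤ * d₀ + (-1ℤ * 1ℤ * m * d₁ + 0ℤ) ≡ - m * d₁
  simplify = solve-∀

-- Toeplitz arrays with a variable first column.

^-neg-cancel : ∀ d n → (- d) ^ n * -1ℤ ^ n ≡ d ^ n
^-neg-cancel d zero    = refl
^-neg-cancel d (suc n) = trans (regroup d ((- d) ^ n) (-1ℤ ^ n)) (cong (d *_) (^-neg-cancel d n))
  where
  regroup : ∀ d u v → - d * u * (-1ℤ * v) ≡ d * (u * v)
  regroup = solve-∀

withFirstColumn : (ℕ → ℤ) → (ℕ → ℕ → ℤ) → ℕ → ℕ → ℤ
withFirstColumn c H i zero    = c i
withFirstColumn c H i (suc j) = H i (suc j)

module _ (a b r : ℤ) where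

  private
    G G̃ : ℕ → ℤ
    G = 𝒢 a b r
    G̃ = alternating G

    d : ℤ
    d = + 2 * b - a * r

    T : ℕ → ℕ → ℤ
    T = toeplitzEntry G̃ G

    bordered : (ℕ → ℤ) → ∀ n → SquareMatrix n
    bordered c n i j = withFirstColumn c T (toℕ i) (toℕ j)

  -- The condition that clears column zero under the row operation. It is the recurrence of `𝒢` run
  -- towards smaller indices, up to the alternating sign, and it is preserved by shifting `c`.
  BackwardRecurrence : (ℕ → ℤ) → Set
  BackwardRecurrence c = ∀ i → c i ≡ r * c (suc i) + c (suc (suc i))

  alternating-backward : BackwardRecurrence G̃
  alternating-backward i = identity (-1ℤ ^ i) r (G i) (G (suc i))
    where
    identity : ∀ s r g h →
      s * g ≡ r * (-1ℤ * s * h) + -1ℤ * (-1ℤ * s) * (r * h + g)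
    identity = solve-∀

  det-bordered-step : ∀ c → BackwardRecurrence c → ∀ n →
    det (bordered c (suc (suc (suc n)))) ≡ - d * det (bordered (c ∘ suc) (suc (suc n)))
  det-bordered-step c c-rec n = begin
    det B
      ≡⟨ det-cong rows ⟩
    det (B₀ ∷ B₁ ∷ B₂ ∷ R)
      ≡⟨ det-addRows (- r) -1ℤ B₀ B₁ B₂ R ⟨
    det N
      ≡⟨ det-singleEntry₁ N N₀≡0 N₂₊≡0 ⟩
    - N zero (suc zero) * det (minor N zero (suc zero))
      ≡⟨ cong₂ (λ u v → - u * v) N₁≡d (det-cong minor-rows) ⟩
    - d * det (bordered (c ∘ suc) (suc (suc n))) ∎
    where
    B : SquareMatrix (suc (suc (suc n)))
    B = bordered c _

    B₀ B₁ B₂ : Vector ℤ (suc (suc (suc n)))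
    B₀ = B zero
    B₁ = B (suc zero)
    B₂ = B (suc (suc zero))

    R : Vector (Vector ℤ (suc (suc (suc n)))) n
    R i = B (suc (suc (suc i)))

    N : SquareMatrix (suc (suc (suc n)))
    N = (λ j → B₀ j + (- r * B₁ j + -1ℤ * B₂ j)) ∷ B₁ ∷ B₂ ∷ R

    rows : ∀ i j → B i j ≡ (B₀ ∷ B₁ ∷ B₂ ∷ R) i j
    rows zero                j = refl
    rows (suc zero)          j = refl
    rows (suc (suc zero))    j = refl
    rows (suc (suc (suc i))) j = refl

    cancel : ∀ r u v → r * u + v + (- r * u + -1ℤ * v) ≡ 0ℤ
    cancel = solve-∀

    N₀≡0 : N zero zero ≡ 0ℤ
    N₀≡0 = trans (cong (_+ (- r * c 1 + -1ℤ * c 2)) (c-rec 0)) (cancel r (c 1) (c 2))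

    -- Column one straddles the diagonal: its top three entries are `b`, `a` and `- b`.
    N₁≡d : N zero (suc zero) ≡ d
    N₁≡d = identity a b r
      where
      identity : ∀ a b r → b + (- r * (1ℤ * a) + -1ℤ * (-1ℤ * 1ℤ * b)) ≡ + 2 * b - a * r
      identity = solve-∀

    N₂₊≡0 : ∀ j → N zero (suc (suc j)) ≡ 0ℤ
    -- Column two is separate because its third entry lies on the diagonal, where it is read from
    -- `G̃` as `1ℤ * a`.
    N₂₊≡0 zero    = identity a b r
      where
      identity : ∀ a b r → r * b + a + (- r * b + -1ℤ * (1ℤ * a)) ≡ 0ℤ
      identity = solve-∀
    N₂₊≡0 (suc j) = cancel r (G (suc (suc (toℕ j)))) (G (suc (toℕ j)))

    -- Deleting row zero advances `c` by one. The columns from two onwards move up and left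
    -- together, so constancy along diagonals preserves their entries.
    minor-rows : ∀ i j →
      minor N zero (suc zero) i j ≡ bordered (c ∘ suc) (suc (suc n)) i j
    minor-rows zero          zero    = refl
    minor-rows (suc zero)    zero    = refl
    minor-rows (suc (suc i)) zero    = refl
    minor-rows zero          (suc j) = refl
    minor-rows (suc zero)    (suc j) = refl
    minor-rows (suc (suc i)) (suc j) = refl

  -- Each step shifts `c` once, so after `n` steps the two by two array with columns (`c n`,
  -- `c (suc n)`) and (`b`, `a`) remains.
  det-bordered : ∀ n c → BackwardRecurrence c →
    det (bordered c (suc (suc n))) ≡ (- d) ^ n * (a * c n - b * c (suc n))
  det-bordered zero c c-rec = identity a b (c 0) (c 1)
    where
    identity : ∀ a b c₀ c₁ →
      1ℤ * c₀ * (1ℤ * (1ℤ * a) * 1ℤ + 0ℤ) + (-1ℤ * 1ℤ * b * (1ℤ * c₁ * 1ℤ + 0ℤ) + 0ℤ) ≡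
      1ℤ * (a * c₀ - b * c₁)
    identity = solve-∀
  det-bordered (suc n) c c-rec = begin
    det (bordered c (suc (suc (suc n))))
      ≡⟨ det-bordered-step c c-rec n ⟩
    - d * det (bordered (c ∘ suc) (suc (suc n)))
      ≡⟨ cong (- d *_) (det-bordered n (c ∘ suc) (c-rec ∘ suc)) ⟩
    - d * ((- d) ^ n * (a * c (suc n) - b * c (suc (suc n))))
      ≡⟨ *-assoc (- d) ((- d) ^ n) _ ⟨
    (- d) ^ suc n * (a * c (suc n) - b * c (suc (suc n))) ∎

  det-toeplitz-suc : ∀ n →
    det (toeplitz G̃ G (suc n)) ≡ d ^ n * (a * G n + b * G (suc n))
  det-toeplitz-suc n = begin
    det (toeplitz G̃ G (suc n))
      ≡⟨ det-cong entries ⟩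
    det (bordered G̃ (suc (suc n)))
      ≡⟨ det-bordered n G̃ alternating-backward ⟩
    (- d) ^ n * (a * G̃ n - b * G̃ (suc n))
      -- The extra sign in `G̃ (suc n)` turns the difference into a sum; the common `-1ℤ ^ n` then
      -- absorbs the signs of `(- d) ^ n`.
      ≡⟨ factor ((- d) ^ n) (-1ℤ ^ n) a (G n) b (G (suc n)) ⟩
    (- d) ^ n * -1ℤ ^ n * (a * G n + b * G (suc n))
      ≡⟨ cong (_* (a * G n + b * G (suc n))) (^-neg-cancel d n) ⟩
    d ^ n * (a * G n + b * G (suc n)) ∎
    where
    entries : ∀ i j → toeplitz G̃ G (suc n) i j ≡ bordered G̃ (suc (suc n)) i j
    entries zero    zero    = refl
    entries (suc i) zero    = refl
    entries i       (suc j) = refl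
    factor : ∀ e s a g b h →
      e * (a * (s * g) - b * (-1ℤ * s * h)) ≡ e * s * (a * g + b * h)
    factor = solve-∀

theorem1 : (a b r : ℤ) → + 1 ≤ r → (n : ℕ) →
    (n ≡ 0 → det (toeplitz (alternating (𝒢 a b r)) (𝒢 a b r) n) ≡ a)
    × (1 ℕ.≤ n → det (toeplitz (alternating (𝒢 a b r)) (𝒢 a b r) n)
    ≡ (+ 2 * b - a * r) ^ (n ∸ 1) * (a * 𝒢 a b r (n ∸ 1) + b * 𝒢 a b r n))
theorem1 a b r _ zero = (λ _ → identity a) , λ ()
  where
  identity : ∀ a → 1ℤ * (1ℤ * a) * 1ℤ + 0ℤ ≡ a
  identity = solve-∀
theorem1 a b r _ (suc n) = (λ ()) , λ _ → det-toeplitz-suc a b r n
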